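{- For every positive integer $n$ there exist a positive integer $t\le 2\log n+1$ and positive integers $a_1,\ldots,a_t$ with $n=a_1+a_2+\cdots+a_t$ such that every integer $q$ with $0\le q\le n$ can be expressed as the sum of a subset of the multiset $\{a_1,\ldots,a_t\}$; that is, for every such $q$ there is $S\subseteq\{1,\ldots,t\}$ with $\sum_{i\in S}a_i=q$.
   Context: Here $\log$ denotes the logarithm to base $2$. The empty subset has sum $0$. -}

module Defs where

open import Level using (0ℓ)
open import Data.Bool using (if_then_else_)
open import Data.Nat using (ℕ; suc; _*_; _^_; _≤_; NonZero)
open import Data.Integer using (+_; -[1+_])
open import Data.Rational.Unnormalised.Properties using (pos⇒nonZero)
open import Data.Rational.Unnormalised as ℚᵘ using (ℚᵘ; mkℚᵘ)
open import Data.Vec using (Vec; sum; zipWith)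
open import Data.Fin.Subset using (Subset)
open import Relation.Unary using (Pred)

-- The standard library has no real numbers.  A real x is represented by its
-- closed lower cut, the predicate r ↦ (r ≤ x) on the rationals.
Cut : Set₁
Cut = Pred ℚᵘ 0ℓ

infix  4 _≤ᶜ_
infixl 6 _+ᶜ_
infixl 7 _·ᶜ_

_≤ᶜ_ : ℚᵘ → Cut → Set
r ≤ᶜ x = x r

-- r ≤ x + c  iff  r - c ≤ x
_+ᶜ_ : Cut → ℚᵘ → Cut
(x +ᶜ c) r = r ℚᵘ.- c ≤ᶜ x

-- For c > 0:  r ≤ c x  iff  r / c ≤ x
_·ᶜ_ : (c : ℚᵘ) .{{_ : ℚᵘ.Positive c}} → Cut → Cut
(c ·ᶜ x) r = (r ℚᵘ.÷ c) {{pos⇒nonZero c}} ≤ᶜ x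

-- r ≤ log₂ n  iff  2 ^ r ≤ n.  For r = p / (d + 1), raising to the power d + 1
-- gives 2 ^ p ≤ n ^ (d + 1); a negative p is moved to the right-hand side.
log₂ : (n : ℕ) .{{_ : NonZero n}} → Cut
log₂ n (mkℚᵘ (+ p)    d) = 2 ^ p ≤ n ^ suc d
log₂ n (mkℚᵘ -[1+ p ] d) = 1 ≤ 2 ^ suc p * n ^ suc d

fromℕ : ℕ → ℚᵘ
fromℕ k = + k ℚᵘ./ 1

-- Σ_{i ∈ S} aᵢ
subsetSum : ∀ {t} → Subset t → Vec ℕ t → ℕ
subsetSum S a = sum (zipWith (λ i∈S aᵢ → if i∈S then aᵢ else 0) S a)

{-# OPTIONS --safe #-}

-- Split n into ⌈n/2⌉ and ⌊n/2⌋, keep ⌈n/2⌉ as a part and recurse on ⌊n/2⌋.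
-- A q ≤ n is either at most ⌊n/2⌋, or at least ⌈n/2⌉ with q - ⌈n/2⌉ ≤ ⌊n/2⌋.
-- Halving n to 1 takes s steps with 2 ^ s ≤ n, which gives the s + 1 parts
-- and even the bound t ≤ log n + 1.
module Submission where

open import Defs
open import Data.Nat using (ℕ; _<_; _≤_; NonZero)
open import Data.Integer using (pos)
open import Data.Vec using (Vec; sum)
open import Data.Vec.Relation.Unary.All using (All)
open import Data.Fin.Subset using (Subset)
open import Data.Product using (Σ-syntax; _×_)
open import Relation.Binary.PropositionalEquality using (_≡_)

open import Data.Bool using (true; false)
open import Data.Empty using (⊥-elim)
open import Data.Nat using (zero; suc; _+_; _*_; _∸_; _^_; _≤?_; ⌊_/2⌋; ⌈_/2⌉; z≤n; s≤s; ≢-nonZero; ≢-nonZero⁻¹)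
open import Data.Nat.Induction using (<-rec)
open import Data.Nat.Properties
import Data.Integer as ℤ
import Data.Integer.Properties as ℤ
open import Data.Product using (_,_)
open import Data.Vec using (_∷_; [])
open import Data.Vec.Relation.Unary.All using (_∷_; [])
open import Relation.Binary.PropositionalEquality using (refl; trans; cong; subst)
open import Relation.Nullary using (yes; no)

record IsComplete {t} (n : ℕ) (a : Vec ℕ t) : Set where
  field
    positive  : All NonZero a
    total     : n ≡ sum a
    represent : ∀ q → q ≤ n → Σ[ S ∈ Subset t ] subsetSum S a ≡ q

open IsComplete

[]-complete : IsComplete 0 []
[]-complete = record
  { positive = [] ; total = refl ; represent = λ { zero z≤n → [] , refl } }

-- Subsets without `c` reach 0 to `h`, those with `c` reach `c` to `c + h`; the bound `c ≤ suc h`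
-- leaves no gap between the two ranges.
∷-complete : ∀ {t h c} {a : Vec ℕ t} .{{_ : NonZero c}} →
             c ≤ suc h → IsComplete h a → IsComplete (c + h) (c ∷ a)
∷-complete {t} {h} {c} {a} c≤1+h H = record
  { positive  = ≢-nonZero (≢-nonZero⁻¹ c) ∷ positive H
  ; total     = cong (c +_) (total H)
  ; represent = rep
  }
  where
  rep : ∀ q → q ≤ c + h → Σ[ S ∈ Subset (suc t) ] subsetSum S (c ∷ a) ≡ q
  rep q q≤c+h with q ≤? h
  ... | yes q≤h with S , eq ← represent H q q≤h = false ∷ S , eq
  ... | no  q≰h with S , eq ← represent H (q ∸ c) (m≤n+o⇒m∸n≤o q c q≤c+h) =
    -- Here `q ≥ suc h ≥ c`, so the truncated `q ∸ c` is a true difference.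
    true ∷ S , trans (cong (c +_) eq) (m+[n∸m]≡n (≤-trans c≤1+h (≰⇒> q≰h)))

⌈n/2⌉+⌊n/2⌋≡n : ∀ n → ⌈ n /2⌉ + ⌊ n /2⌋ ≡ n
⌈n/2⌉+⌊n/2⌋≡n n = trans (+-comm ⌈ n /2⌉ ⌊ n /2⌋) (⌊n/2⌋+⌈n/2⌉≡n n)

⌈n/2⌉≤1+⌊n/2⌋ : ∀ n → ⌈ n /2⌉ ≤ suc ⌊ n /2⌋
-- By computation the two sides are the floors of half of `suc n` and of half of `suc (suc n)`.
⌈n/2⌉≤1+⌊n/2⌋ n = ⌊n/2⌋-mono (n≤1+n (suc n))

2*⌊n/2⌋≤n : ∀ n → 2 * ⌊ n /2⌋ ≤ n
2*⌊n/2⌋≤n n = begin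
  2 * ⌊ n /2⌋         ≡⟨ cong (⌊ n /2⌋ +_) (+-identityʳ ⌊ n /2⌋) ⟩
  ⌊ n /2⌋ + ⌊ n /2⌋   ≤⟨ +-monoʳ-≤ ⌊ n /2⌋ (⌊n/2⌋≤⌈n/2⌉ n) ⟩
  ⌊ n /2⌋ + ⌈ n /2⌉   ≡⟨ ⌊n/2⌋+⌈n/2⌉≡n n ⟩
  n                   ∎
  where open ≤-Reasoning

-- `2 ^ s ≤ n` expresses `s ≤ log n` within ℕ; a new part raises `s` by one and so doubles the left
-- side.
CompleteParts : ℕ → Set
CompleteParts n = Σ[ s ∈ ℕ ] 2 ^ s ≤ n × (Σ[ a ∈ Vec ℕ (suc s) ] IsComplete n a)

completeParts : ∀ m → CompleteParts (suc m)
completeParts = <-rec (λ m → CompleteParts (suc m)) step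
  where
  step : ∀ m → (∀ {k} → k < m → CompleteParts (suc k)) → CompleteParts (suc m)
  step zero    rec = 0 , s≤s z≤n , 1 ∷ [] , ∷-complete (s≤s z≤n) []-complete
  -- For `n = suc (suc m)`, `⌊ n /2⌋` reduces to `suc ⌊ m /2⌋`: the half stays positive and the
  -- induction hypothesis is used at `⌊ m /2⌋`.
  step (suc m) rec with s , 2^s≤h , a , H ← rec (s≤s (⌊n/2⌋≤n m)) =
    suc s ,
    ≤-trans (*-monoʳ-≤ 2 2^s≤h) (2*⌊n/2⌋≤n n) ,
    ⌈ n /2⌉ ∷ a ,
    subst (λ k → IsComplete k (⌈ n /2⌉ ∷ a)) (⌈n/2⌉+⌊n/2⌋≡n n)
      (∷-complete (⌈n/2⌉≤1+⌊n/2⌋ n) H)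
    where n = suc (suc m)

-- The cut at 1 + s unfolds to 2 ^ s ≤ n ^ 2, as (1 + s - 1) / 2 = s / 2.
2^s≤n⇒1+s≤2log₂n+1 : ∀ n s .{{_ : NonZero n}} → 2 ^ s ≤ n →
                      fromℕ (suc s) ≤ᶜ fromℕ 2 ·ᶜ log₂ n +ᶜ fromℕ 1
2^s≤n⇒1+s≤2log₂n+1 n s 2^s≤n
  -- The rewrites clear the factors 1 that rational subtraction and division leave in the numerator.
  rewrite *-identityʳ s | ℤ.*-identityʳ (ℤ.+ s) =
  ≤-trans 2^s≤n (m≤m*n n (n ^ 1) {{m^n≢0 n 1}})

lemma1 : (n : ℕ) .{{_ : NonZero n}} →
    Σ[ t ∈ ℕ ] 0 < t × fromℕ t ≤ᶜ fromℕ 2 ·ᶜ log₂ n +ᶜ fromℕ 1 ×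
    (Σ[ a ∈ Vec ℕ t ] All NonZero a × n ≡ sum a ×
    (∀ (q : ℕ) → q ≤ n → Σ[ S ∈ Subset t ] subsetSum S a ≡ q))
lemma1 zero = ⊥-elim (≢-nonZero⁻¹ 0 refl)
lemma1 (suc m) with s , 2^s≤n , a , H ← completeParts m =
  suc s , s≤s z≤n , 2^s≤n⇒1+s≤2log₂n+1 (suc m) s 2^s≤n ,
  a , positive H , total H , represent H
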